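{- Let $\Sigma=\{0,1\}$ and let $\hat\mu$ be the standard uniform distribution on $\Sigma^*$. For every function $f:\Sigma^*\to\Sigma^*$, if the distributional problem $(f,\hat\mu)$ is in $\mathrm{AvgP}$, then $f$ has a frequently self-knowingly correct polynomial-time algorithm.
   Context: $\Sigma=\{0,1\}$; $\Sigma^*$ is the set of finite strings over $\Sigma$, and $\Sigma^n$ the set of strings of length exactly $n$. $|x|$ is the length of $x$. All algorithms are deterministic. Distribution functions: a distribution function $\mu:\Sigma^*\to[0,1]$ is a nondecreasing function (with respect to lexicographic order on strings) that converges to one; its density is $\mu'(x)=\mu(x)-\mu(x-1)$, where $x-1$ is the predecessor of $x$ (and the density of the first string is its $\mu$-value). So each string $x$ has weight $\mu'(x)$. A distributional (search) problem is a pair $(f,\mu)$ with $f:\Sigma^*\to\Sigma^*$ a function and $\mu$ a distribution function. Standard uniform distribution: $\hat\mu$ has density $\hat\mu'(x)=\frac{1}{|x|(|x|+1)2^{|x|}}$ for $|x|\ge 1$; the empty string has weight zero (and is excluded from the sum below). Polynomial on the average: a function $t:\Sigma^*\to\mathbb{N}$ is polynomial on the average with respect to $\mu$ if there exists a constant $\epsilon>0$ such that $\sum_{x\in\Sigma^*}\mu'(x)\cdot\frac{t(x)^\epsilon}{|x|}<\infty$. $\mathrm{AvgP}$ is the class of all distributional problems $(f,\mu)$ for which there exists an algorithm computing $f$ whose running time is polynomial on the average with respect to $\mu$. Self-knowing correctness: for a function $g:\Sigma^*\to T$, an algorithm $\mathcal{B}:\Sigma^*\to T\times\{\text{"definitely"},\text{"maybe"}\}$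 is self-knowingly correct for $g$ if, for each $s\in\Sigma^*$ and $t\in T$, whenever $\mathcal{B}$ on input $s$ outputs $(t,\text{"definitely"})$ then $g(s)=t$. It is frequently self-knowingly correct for $g$ if it is self-knowingly correct for $g$ and $$\lim_{n\to\infty}\frac{\|\{x\in\Sigma^n \mid \mathcal{B}(x)\in T\times\{\text{"maybe"}\}\}\|}{\|\Sigma^n\|}=0,$$ where $\|\cdot\|$ denotes cardinality. A polynomial-time such algorithm is one whose running time is bounded by a polynomial in $|x|$. Here $T=\Sigma^*$. -}

module Defs where

import Algebra.Definitions.RawSemiring
open import Data.Bool.Base as Bool using (Bool; true; false; if_then_else_)
open import Data.Fin.Base using (Fin)
open import Data.Integer.Base as ℤ using (+_)
import Data.Integer.Properties as ℤ
open import Data.Integer.Properties using (pos-*; pos-+)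
open import Data.List.Base as List
  using (List; []; _∷_; _++_; length; map; replicate; filterᵇ; foldr)
import Data.List.Properties as List
open import Data.List.Relation.Binary.Lex.Core using (Lex-≤; base; halt; this; next)
open import Data.List.Relation.Unary.Unique.Propositional using (Unique)
open import Data.Maybe.Base as Maybe using (Maybe; just; nothing; fromMaybe; _>>=_)
open import Data.Nat.Base as ℕ using (ℕ; zero; suc; _+_; _*_; _^_; NonZero; z≤n; s≤s)
import Data.Nat.Properties as ℕ
open import Data.Nat.Solver using (module +-*-Solver)
open import Data.Product.Base using (∃; Σ-syntax; ∃-syntax; _×_; _,_; proj₁; proj₂)
open import Data.Rational.Base as ℚ using (ℚ; 0ℚ; 1ℚ; _/_; ↧ₙ_; ↥_)
import Data.Rational.Properties as ℚ
import Data.Rational.Unnormalised.Base as ℚᵘ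
import Data.Rational.Unnormalised.Properties as ℚᵘ
open import Data.Sum.Base using (_⊎_; inj₁; inj₂)
open import Data.Vec.Base as Vec using (Vec; _∷_)
open import Function.Base using (_∘_)
open import Function.Bundles using (_↔_; _⇔_; mk⇔)
open import Relation.Binary.PropositionalEquality
open import Relation.Nullary using (¬_; yes; no)

open Algebra.Definitions.RawSemiring ℚ.+-*-rawSemiring public
  using () renaming (_^_ to _^ℚ_)

Str : Set
Str = List Bool

strings : ℕ → List Str
strings zero    = [] ∷ []
strings (suc n) = map (false ∷_) (strings n) ++ map (true ∷_) (strings n)

strings-nonempty : ∀ n → NonZero (length (strings n))
strings-nonempty zero    = _
strings-nonempty (suc n) = subst NonZero
  (sym (trans (List.length-++ (map (false ∷_) (strings n)))
              (cong (_+ length (map (true ∷_) (strings n)))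
                    (List.length-map (false ∷_) (strings n)))))
  (ℕ.>-nonZero (ℕ.<-≤-trans (ℕ.>-nonZero⁻¹ _ {{strings-nonempty n}}) (ℕ.m≤m+n _ _)))

-- The standard ("length-lexicographic") order ε, 0, 1, 00, 01, …, in which
-- every string except the empty one has an immediate predecessor.

infix 4 _≼_

_≼_ : Str → Str → Set
x ≼ y = length x ℕ.< length y ⊎
        (length x ≡ length y × Lex-≤ _≡_ Bool._<_ x y)

-- Binary decrement, most significant bit first; undefined on 0…0.

decrement : Str → Maybe Str
decrement []      = nothing
decrement (b ∷ x) with decrement x
... | just y  = just (b ∷ y)
... | nothing = if b then just (false ∷ replicate (length x) true) else nothing

predecessor : Str → Maybe Str
predecessor []      = nothing
predecessor (b ∷ x) =
  just (fromMaybe (replicate (length x) true) (decrement (b ∷ x)))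

record ℝ : Set₁ where
  field
    lower upper     : ℚ → Set
    lower-inhabited : ∃ lower
    upper-inhabited : ∃ upper
    lower-closed    : ∀ {q r} → q ℚ.< r → lower r → lower q
    upper-closed    : ∀ {q r} → q ℚ.< r → upper q → upper r
    lower-open      : ∀ {q} → lower q → ∃[ r ] q ℚ.< r × lower r
    upper-open      : ∀ {q} → upper q → ∃[ r ] r ℚ.< q × upper r
    disjoint        : ∀ {q} → ¬ (lower q × upper q)
    located         : ∀ {q r} → q ℚ.< r → lower q ⊎ upper r

infix 4 _<ℝ_ _ℝ<_ _≤ℝ_

_<ℝ_ : ℚ → ℝ → Set
q <ℝ x = ℝ.lower x q

_ℝ<_ : ℝ → ℚ → Set
x ℝ< q = ℝ.upper x q

_≤ℝ_ : ℝ → ℝ → Set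
x ≤ℝ y = ∀ q → q <ℝ x → q <ℝ y

private
  p-1<p : ∀ p → p ℚ.- 1ℚ ℚ.< p
  p-1<p p = subst (p ℚ.- 1ℚ ℚ.<_) (ℚ.+-identityʳ p)
              (ℚ.+-monoʳ-< p (ℚ.negative⁻¹ (ℚ.- 1ℚ)))

  p<p+1 : ∀ p → p ℚ.< p ℚ.+ 1ℚ
  p<p+1 p = subst (ℚ._< p ℚ.+ 1ℚ) (ℚ.+-identityʳ p)
              (ℚ.+-monoʳ-< p (ℚ.positive⁻¹ 1ℚ))

fromℚ : ℚ → ℝ
fromℚ p = record
  { lower           = ℚ._< p
  ; upper           = p ℚ.<_
  ; lower-inhabited = p ℚ.- 1ℚ , p-1<p p
  ; upper-inhabited = p ℚ.+ 1ℚ , p<p+1 p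
  ; lower-closed    = ℚ.<-trans
  ; upper-closed    = λ q<r p<q → ℚ.<-trans p<q q<r
  ; lower-open      = λ q<p → let m , q<m , m<p = ℚ.<-dense q<p in m , q<m , m<p
  ; upper-open      = λ p<q → let m , p<m , m<q = ℚ.<-dense p<q in m , m<q , p<m
  ; disjoint        = λ (q<p , p<q) → ℚ.<-asym q<p p<q
  ; located         = loc
  }
  where
  loc : ∀ {q r} → q ℚ.< r → q ℚ.< p ⊎ p ℚ.< r
  loc {q} q<r with q ℚ.<? p
  ... | yes q<p = inj₁ q<p
  ... | no  q≮p = inj₂ (ℚ.≤-<-trans (ℚ.≮⇒≥ q≮p) q<r)

record Distribution : Set₁ where
  field
    μ             : Str → ℝ
    nonnegative   : ∀ x → fromℚ 0ℚ ≤ℝ μ x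
    at-most-one   : ∀ x → μ x ≤ℝ fromℚ 1ℚ
    nondecreasing : ∀ x y → x ≼ y → μ x ≤ℝ μ y
    converges     : ∀ δ → 0ℚ ℚ.< δ →
                    ∃[ x ] ∀ y → x ≼ y → 1ℚ ℚ.- δ <ℝ μ y × μ y ℝ< 1ℚ ℚ.+ δ

-- The lower cut of the density μ′(x) = μ(x) − μ(x−1), or μ(x) if x is the
-- first string:  q < μ(x) − μ(x−1)  iff  q + s < μ(x) for some s > μ(x−1).

BelowDensity : Distribution → Str → ℚ → Set
BelowDensity D x q with predecessor x
... | nothing = q <ℝ Distribution.μ D x
... | just w  = ∃[ s ] Distribution.μ D w ℝ< s × q ℚ.+ s <ℝ Distribution.μ D x

DistributionalProblem : Set₁
DistributionalProblem = (Str → Str) × Distribution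

private
  denominator-nonZero : ∀ n .{{_ : NonZero n}} → NonZero (n * suc n * 2 ^ n)
  denominator-nonZero n = ℕ.m*n≢0 (n * suc n) (2 ^ n)
    {{ℕ.m*n≢0 n (suc n)}} {{ℕ.m^n≢0 2 n}}

uniformDensity : Str → ℚ
uniformDensity []        = 0ℚ
uniformDensity x@(_ ∷ _) = (+ 1 / (n * suc n * 2 ^ n)) {{denominator-nonZero n}}
  where n = length x

-- The number of strings of the same length strictly below x.

value : Str → ℕ
value []      = 0
value (b ∷ x) = (if b then 2 ^ length x else 0) + value x

-- For |x| = n ≥ 1 the strings shorter than x have total weight
-- Σ_{1≤m<n} 1/(m(m+1)) = (n−1)/n, and x is preceded by  value x  strings of
-- its own length.  That this function has density uniformDensity is
-- standardUniform-density below.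

uniformCDF : Str → ℚ
uniformCDF []          = 0ℚ
uniformCDF x@(_ ∷ y) =
  (+ length y / n) ℚ.+ (+ suc (value x) / (n * suc n * 2 ^ n)) {{denominator-nonZero n}}
  where n = length x

private
  module Frac where
    to : ∀ a b .{{_ : NonZero b}} → ℚ.toℚᵘ (+ a / b) ℚᵘ.≃ (+ a ℚᵘ./ b)
    to a (suc b) = ℚ.toℚᵘ-fromℚᵘ (ℚᵘ.mkℚᵘ (+ a) b)

    frac-≤ : ∀ a b c d .{{_ : NonZero b}} .{{_ : NonZero d}} →
             a * d ℕ.≤ c * b → + a / b ℚ.≤ + c / d
    frac-≤ a b@(suc _) c d@(suc _) h = ℚ.toℚᵘ-cancel-≤
      (ℚᵘ.≤-respˡ-≃ (ℚᵘ.≃-sym (to a b)) (ℚᵘ.≤-respʳ-≃ (ℚᵘ.≃-sym (to c d))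
        (ℚᵘ.*≤* (subst₂ ℤ._≤_ (pos-* a d) (pos-* c b) (ℤ.+≤+ h)))))

    frac-+ : ∀ a b c d e f .{{_ : NonZero b}} .{{_ : NonZero d}} .{{_ : NonZero f}} →
             (a * d + c * b) * f ≡ e * (b * d) → (+ a / b) ℚ.+ (+ c / d) ≡ + e / f
    frac-+ a b@(suc _) c d@(suc _) e f@(suc _) h = ℚ.toℚᵘ-injective
      (ℚᵘ.≃-trans (ℚ.toℚᵘ-homo-+ (+ a / b) (+ c / d))
      (ℚᵘ.≃-trans (ℚᵘ.+-cong (to a b) (to c d))
      (ℚᵘ.≃-trans (ℚᵘ.*≡* eq) (ℚᵘ.≃-sym (to e f)))))
      where
      eq : (+ a ℤ.* + d ℤ.+ + c ℤ.* + b) ℤ.* + f ≡ + e ℤ.* + (b * d)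
      eq = begin
        (+ a ℤ.* + d ℤ.+ + c ℤ.* + b) ℤ.* + f
          ≡⟨ cong (ℤ._* + f) (cong₂ ℤ._+_ (sym (pos-* a d)) (sym (pos-* c b))) ⟩
        + (a * d + c * b) ℤ.* + f ≡⟨ sym (pos-* (a * d + c * b) f) ⟩
        + ((a * d + c * b) * f)   ≡⟨ cong +_ h ⟩
        + (e * (b * d))           ≡⟨ pos-* e (b * d) ⟩
        + e ℤ.* + (b * d)         ∎
        where open ≡-Reasoning

    frac-pos : ∀ a b .{{_ : NonZero b}} → 0ℚ ℚ.< + suc a / b
    frac-pos a b = ℚ.positive⁻¹ (+ suc a / b) {{ℚ.normalize-pos (suc a) b}}

  open Frac
  open +-*-Solver using (solve; _:+_; _:*_; con; _:=_)

  value<2^ : ∀ x → value x ℕ.< 2 ^ length x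
  value<2^ []          = s≤s z≤n
  value<2^ (true  ∷ x) = ℕ.≤-trans
    (ℕ.+-monoʳ-< (2 ^ length x) (value<2^ x))
    (ℕ.≤-reflexive (cong (_+_ (2 ^ length x)) (sym (ℕ.+-identityʳ _))))
  value<2^ (false ∷ x) = ℕ.<-≤-trans (value<2^ x) (ℕ.m≤m+n _ _)

  module _ (m : ℕ) where
    n = suc m
    D = n * suc n * 2 ^ n
    instance
      D≢0 : NonZero D
      D≢0 = denominator-nonZero n

    full : ∀ v → v ≡ 2 ^ n → (+ m / n) ℚ.+ (+ v / D) ≡ + n / suc n
    full v refl = frac-+ m n (2 ^ n) D n (suc n)
      (solve 2 (λ M P →
         let N = con 1 :+ M ; S = con 1 :+ N in
         (M :* (N :* S :* P) :+ P :* N) :* S := N :* (N :* (N :* S :* P)))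
       refl m (2 ^ n))

  cell : ℕ → ℕ → ℚ
  cell m v = (+ m / n m) ℚ.+ (+ suc v / D m) {{D≢0 m}}

  cell-mono : ∀ m {u v} → u ℕ.≤ v → cell m u ℚ.≤ cell m v
  cell-mono m {u} {v} u≤v = ℚ.+-monoʳ-≤ (+ m / n m)
    (frac-≤ (suc u) (D m) (suc v) (D m) (ℕ.*-monoˡ-≤ (D m) (s≤s u≤v)))
    where instance _ = D≢0 m

  cell-full : ∀ m v → suc v ≡ 2 ^ n m → cell m v ≡ + n m / suc (n m)
  cell-full m v = full m (suc v)

  cdf-≤ : ∀ b y → uniformCDF (b ∷ y) ℚ.≤ + suc (length y) / suc (suc (length y))
  cdf-≤ b y = subst (uniformCDF (b ∷ y) ℚ.≤_) (full m _ refl)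
    (ℚ.+-monoʳ-≤ (+ m / n m) (frac-≤ (suc (value (b ∷ y))) (D m) (2 ^ n m) (D m)
      (ℕ.*-monoˡ-≤ (D m) (value<2^ (b ∷ y)))))
    where m = length y
          instance _ = D≢0 m

  cdf-> : ∀ b y → + length y / suc (length y) ℚ.< uniformCDF (b ∷ y)
  cdf-> b y = subst (ℚ._< uniformCDF (b ∷ y)) (ℚ.+-identityʳ (+ m / n m))
    (ℚ.+-monoʳ-< (+ m / n m) (frac-pos (value (b ∷ y)) (D m)))
    where m = length y
          instance _ = D≢0 m

  cdf-≥0 : ∀ x → 0ℚ ℚ.≤ uniformCDF x
  cdf-≥0 []      = ℚ.≤-refl
  cdf-≥0 (b ∷ y) = ℚ.<⇒≤ (ℚ.≤-<-trans (frac-≤ 0 1 (length y) (suc (length y)) z≤n) (cdf-> b y))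

  cdf-≤1 : ∀ x → uniformCDF x ℚ.≤ 1ℚ
  cdf-≤1 []      = ℚ.<⇒≤ (ℚ.positive⁻¹ 1ℚ)
  cdf-≤1 (b ∷ y) = ℚ.≤-trans (cdf-≤ b y)
    (frac-≤ (suc (length y)) (suc (suc (length y))) 1 1
      (subst₂ ℕ._≤_ (sym (ℕ.*-identityʳ _)) (sym (ℕ.*-identityˡ _)) (ℕ.n≤1+n _)))

  value-mono : ∀ {x y} → length x ≡ length y → Lex-≤ _≡_ Bool._<_ x y → value x ℕ.≤ value y
  value-mono _ (base _) = z≤n
  value-mono _ halt     = z≤n
  value-mono {_ ∷ x} {_ ∷ y} e (this Bool.f<t) = ℕ.≤-trans (ℕ.<⇒≤ (value<2^ x))
    (ℕ.≤-trans (ℕ.≤-reflexive (cong (2 ^_) (ℕ.suc-injective e))) (ℕ.m≤m+n _ (value y)))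
  value-mono {b ∷ x} {_ ∷ y} e (next refl l) = ℕ.+-mono-≤
    (ℕ.≤-reflexive (cong (λ k → if b then 2 ^ k else 0) (ℕ.suc-injective e)))
    (value-mono (ℕ.suc-injective e) l)

  cdf-mono-= : ∀ x y → length x ≡ length y → value x ℕ.≤ value y → uniformCDF x ℚ.≤ uniformCDF y
  cdf-mono-= []      []      _ _ = ℚ.≤-refl
  cdf-mono-= (b ∷ x) (c ∷ y) e h = ℚ.≤-trans
    (ℚ.≤-reflexive (cong (λ k → cell k (value (b ∷ x))) (ℕ.suc-injective e)))
    (cell-mono (length y) h)

  ratio-mono : ∀ {k l} → k ℕ.≤ l → + k / suc k ℚ.≤ + l / suc l
  ratio-mono {k} {l} k≤l = frac-≤ k (suc k) l (suc l)
    (subst₂ ℕ._≤_ (sym (ℕ.*-suc k l)) (sym (ℕ.*-suc l k))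
      (ℕ.+-mono-≤ k≤l (ℕ.≤-reflexive (ℕ.*-comm k l))))

  cdf-mono : ∀ x y → x ≼ y → uniformCDF x ℚ.≤ uniformCDF y
  cdf-mono x       y       (inj₂ (e , l)) = cdf-mono-= x y e (value-mono e l)
  cdf-mono []      y       (inj₁ _)       = cdf-≥0 y
  cdf-mono (b ∷ x) (c ∷ y) (inj₁ (s≤s h)) =
    ℚ.≤-trans (cdf-≤ b x) (ℚ.≤-trans (ratio-mono h) (ℚ.<⇒≤ (cdf-> c y)))

  complement : ∀ m → (+ m / suc m) ℚ.+ (+ 1 / suc m) ≡ 1ℚ
  complement m = frac-+ m (suc m) 1 (suc m) 1 1
    (solve 1 (λ M → let N = con 1 :+ M in
       (M :* N :+ con 1 :* N) :* con 1 := con 1 :* (N :* N)) refl m)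

  reciprocal-≤ : ∀ δ m → 0ℚ ℚ.< δ → ↧ₙ δ ℕ.≤ suc m → + 1 / suc m ℚ.≤ δ
  reciprocal-≤ δ@(ℚ.mkℚ (+ suc p) q _) m _ h = subst (+ 1 / suc m ℚ.≤_) (ℚ.↥p/↧p≡p δ)
    (frac-≤ 1 (suc m) (suc p) (suc q)
      (ℕ.≤-trans (ℕ.≤-reflexive (ℕ.*-identityˡ _)) (ℕ.≤-trans h (ℕ.m≤m+n (suc m) (p * suc m)))))
  reciprocal-≤ (ℚ.mkℚ (+ 0) q _)         m 0<δ h with ℚ.positive 0<δ
  ... | ()
  reciprocal-≤ (ℚ.mkℚ (ℤ.-[1+ p ]) q _) m 0<δ h with ℚ.positive 0<δ
  ... | ()

  cancel : ∀ p q → (p ℚ.+ q) ℚ.- q ≡ p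
  cancel p q = trans (ℚ.+-assoc p q (ℚ.- q))
    (trans (cong (p ℚ.+_) (ℚ.+-inverseʳ q)) (ℚ.+-identityʳ p))

  cancel′ : ∀ p q → (p ℚ.- q) ℚ.+ q ≡ p
  cancel′ p q = trans (ℚ.+-assoc p (ℚ.- q) q)
    (trans (cong (p ℚ.+_) (ℚ.+-inverseˡ q)) (ℚ.+-identityʳ p))

  cdf-tail : ∀ δ → 0ℚ ℚ.< δ → ∀ y → ↧ₙ δ ℕ.≤ length y → 1ℚ ℚ.- δ ℚ.< uniformCDF y
  cdf-tail δ 0<δ []      ()
  cdf-tail δ 0<δ (b ∷ y) h = ℚ.≤-<-trans bound (cdf-> b y)
    where
    m = length y
    r = + 1 / suc m
    bound : 1ℚ ℚ.- δ ℚ.≤ + m / suc m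
    bound = ℚ.≤-trans (ℚ.+-monoʳ-≤ 1ℚ (ℚ.neg-antimono-≤ (reciprocal-≤ δ m 0<δ h)))
      (ℚ.≤-reflexive (trans (cong (ℚ._- r) (sym (complement m))) (cancel (+ m / suc m) r)))

  ≼⇒length : ∀ {x y} → x ≼ y → length x ℕ.≤ length y
  ≼⇒length (inj₁ h)       = ℕ.<⇒≤ h
  ≼⇒length (inj₂ (e , _)) = ℕ.≤-reflexive e

standardUniform : Distribution
standardUniform = record
  { μ             = fromℚ ∘ uniformCDF
  ; nonnegative   = λ x q q<0 → ℚ.<-≤-trans q<0 (cdf-≥0 x)
  ; at-most-one   = λ x q q<μ → ℚ.<-≤-trans q<μ (cdf-≤1 x)
  ; nondecreasing = λ x y x≼y q q<μ → ℚ.<-≤-trans q<μ (cdf-mono x y x≼y)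
  ; converges     = λ δ 0<δ → replicate (↧ₙ δ) false , λ y x≼y →
      cdf-tail δ 0<δ y (subst (ℕ._≤ length y) (List.length-replicate (↧ₙ δ)) (≼⇒length x≼y)) ,
      ℚ.≤-<-trans (cdf-≤1 y)
        (subst (ℚ._< 1ℚ ℚ.+ δ) (ℚ.+-identityʳ 1ℚ) (ℚ.+-monoʳ-< 1ℚ 0<δ))
  }

private
  value-ones : ∀ m → suc (value (replicate m true)) ≡ 2 ^ m
  value-ones zero    = refl
  value-ones (suc m) = trans
    (cong (λ k → suc (2 ^ k + value (replicate m true))) (List.length-replicate m))
    (trans (sym (ℕ.+-suc (2 ^ m) _))
      (cong (_+_ (2 ^ m)) (trans (value-ones m) (sym (ℕ.+-identityʳ _)))))

  decrement-spec : ∀ x →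
    (decrement x ≡ nothing × value x ≡ 0) ⊎
    (∃[ y ] decrement x ≡ just y × length y ≡ length x × value x ≡ suc (value y))
  decrement-spec [] = inj₁ (refl , refl)
  decrement-spec (b ∷ x) with decrement x | decrement-spec x
  ... | just y | inj₂ (.y , refl , e , h) = inj₂ (b ∷ y , refl , cong suc e ,
    trans (cong₂ (λ k v → (if b then 2 ^ k else 0) + v) (sym e) h)
          (ℕ.+-suc (if b then 2 ^ length y else 0) (value y)))
  decrement-spec (true ∷ x) | nothing | inj₁ (_ , h) =
    inj₂ (_ , refl , cong suc (List.length-replicate (length x)) ,
      trans (cong (_+_ (2 ^ length x)) h)
        (trans (ℕ.+-identityʳ _) (sym (value-ones (length x)))))
  decrement-spec (false ∷ x) | nothing | inj₁ (_ , h) = inj₁ (refl , h)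

  add-one : ∀ v E .{{_ : NonZero E}} → (+ v / E) ℚ.+ (+ 1 / E) ≡ + suc v / E
  add-one v E = frac-+ v E 1 E (suc v) E
    (solve 2 (λ V F → (V :* F :+ con 1 :* F) :* F := (con 1 :+ V) :* (F :* F)) refl v E)

  cell-step : ∀ m v →
    cell m v ℚ.+ (+ 1 / D m) {{D≢0 m}} ≡ cell m (suc v)
  cell-step m v = trans (ℚ.+-assoc (+ m / n m) (+ suc v / D m) (+ 1 / D m))
    (cong (ℚ._+_ (+ m / n m)) (add-one (suc v) (D m)))
    where instance _ = D≢0 m

  cdf-ones : ∀ m → uniformCDF (replicate m true) ≡ + m / suc m
  cdf-ones zero    = refl
  cdf-ones (suc m) = trans
    (cong (λ k → cell k (value (replicate (suc m) true))) (List.length-replicate m))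
    (cell-full m (value (replicate (suc m) true)) (value-ones (suc m)))

  cdf-zeros : ∀ b y → value (b ∷ y) ≡ 0 →
    uniformCDF (replicate (length y) true) ℚ.+ uniformDensity (b ∷ y) ≡ uniformCDF (b ∷ y)
  cdf-zeros b y h = trans
    (cong (ℚ._+ uniformDensity (b ∷ y)) (cdf-ones (length y)))
    (cong (cell (length y)) (sym h))

  cdf-step : ∀ b y z → length z ≡ suc (length y) → value (b ∷ y) ≡ suc (value z) →
    uniformCDF z ℚ.+ uniformDensity (b ∷ y) ≡ uniformCDF (b ∷ y)
  cdf-step b y (c ∷ z) e h = trans
    (cong (λ k → cell k (value (c ∷ z)) ℚ.+ uniformDensity (b ∷ y)) (ℕ.suc-injective e))
    (trans (cell-step (length y) (value (c ∷ z))) (cong (cell (length y)) (sym h)))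

  cdf-predecessor : ∀ b y →
    uniformCDF (fromMaybe (replicate (length y) true) (decrement (b ∷ y)))
      ℚ.+ uniformDensity (b ∷ y) ≡ uniformCDF (b ∷ y)
  cdf-predecessor b y = by-cases (decrement-spec (b ∷ y))
    where
    P : Maybe Str → Set
    P d = uniformCDF (fromMaybe (replicate (length y) true) d)
      ℚ.+ uniformDensity (b ∷ y) ≡ uniformCDF (b ∷ y)

    by-cases : _ → P (decrement (b ∷ y))
    by-cases (inj₁ (d , h))         = subst P (sym d) (cdf-zeros b y h)
    by-cases (inj₂ (z , d , e , h)) = subst P (sym d) (cdf-step b y z e h)

  below-difference : ∀ u d c q → u ℚ.+ d ≡ c →
    (∃[ s ] u ℚ.< s × q ℚ.+ s ℚ.< c) ⇔ q ℚ.< d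
  below-difference u d c q u+d = mk⇔ to′ from′
    where
    to′ : ∃[ s ] u ℚ.< s × q ℚ.+ s ℚ.< c → q ℚ.< d
    to′ (s , u<s , h) = subst₂ ℚ._<_ (cancel q u) (cancel d u)
      (ℚ.+-monoˡ-< (ℚ.- u) (ℚ.<-trans (ℚ.+-monoʳ-< q u<s)
        (subst (q ℚ.+ s ℚ.<_) (trans (sym u+d) (ℚ.+-comm u d)) h)))

    from′ : q ℚ.< d → ∃[ s ] u ℚ.< s × q ℚ.+ s ℚ.< c
    from′ q<d with ℚ.<-dense (subst (ℚ._< (d ℚ.+ u) ℚ.- q)
      (trans (cong (ℚ._- q) (ℚ.+-comm q u)) (cancel u q))
      (ℚ.+-monoˡ-< (ℚ.- q) (ℚ.+-monoˡ-< u q<d)))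
    ... | s , u<s , s<c = s , u<s , subst₂ ℚ._<_ (ℚ.+-comm s q)
      (trans (cancel′ (d ℚ.+ u) q) (trans (ℚ.+-comm d u) u+d)) (ℚ.+-monoˡ-< q s<c)

standardUniform-density : ∀ x q → BelowDensity standardUniform x q ⇔ q ℚ.< uniformDensity x
standardUniform-density []      q = mk⇔ (λ h → h) (λ h → h)
standardUniform-density (b ∷ y) q = below-difference
  (uniformCDF (fromMaybe (replicate (length y) true) (decrement (b ∷ y))))
  (uniformDensity (b ∷ y)) (uniformCDF (b ∷ y)) q (cdf-predecessor b y)

-- Algorithms are deterministic multi-tape Turing machines with two-way
-- infinite tapes.

Finite : Set → Set
Finite A = ∃[ n ] A ↔ Fin n

data Symbol (A : Set) : Set where
  blank : Symbol A
  bit   : Bool → Symbol A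
  aux   : A → Symbol A

data Move : Set where
  left stay right : Move

-- All cells not listed are blank; `before` lists the cells to the left of
-- the head, nearest first.

record Tape (A : Set) : Set where
  constructor tape
  field
    before  : List (Symbol A)
    current : Symbol A
    after   : List (Symbol A)

module _ {A : Set} where

  load : Str → Tape A
  load []      = tape [] blank []
  load (b ∷ x) = tape [] (bit b) (map bit x)

  leadingBits : List (Symbol A) → Str
  leadingBits (bit b ∷ s) = b ∷ leadingBits s
  leadingBits _           = []

  move : Move → Tape A → Tape A
  move left  (tape []      s r)       = tape [] blank (s ∷ r)
  move left  (tape (p ∷ l) s r)       = tape l p (s ∷ r)
  move stay  t                        = t
  move right (tape l       s [])      = tape (s ∷ l) blank []
  move right (tape l       s (p ∷ r)) = tape (s ∷ l) p r

  act : Symbol A × Move → Tape A → Tape A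
  act (s , m) (tape l _ r) = move m (tape l s r)

-- Tape zero carries the input and the output; δ returns nothing to halt.

record Machine : Set₁ where
  field
    State        : Set
    Aux          : Set
    state-finite : Finite State
    aux-finite   : Finite Aux
    extraTapes   : ℕ
    start        : State
    δ            : State → Vec (Symbol Aux) (suc extraTapes) →
                   Maybe (State × Vec (Symbol Aux × Move) (suc extraTapes))

  Config : Set
  Config = State × Vec (Tape Aux) (suc extraTapes)

  initial : Str → Config
  initial x = start , load x ∷ Vec.replicate extraTapes (load [])

  step : Config → Maybe Config
  step (q , ts) = Maybe.map
    (λ (q′ , acts) → q′ , Vec.zipWith act acts ts)
    (δ q (Vec.map Tape.current ts))

  run : ℕ → Config → Maybe Config
  run zero    c = just c
  run (suc n) c = step c >>= run n

  -- The maximal bit string on tape zero starting at the head.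

  output : Config → Str
  output (_ , t ∷ _) = leadingBits (Tape.current t ∷ Tape.after t)

-- M computes f, halting on each input x after exactly t x steps.

Computes_InTime_By_ : (Str → Str) → (Str → ℕ) → Machine → Set
Computes f InTime t By M = ∀ x →
  ∃[ c ] run (t x) (initial x) ≡ just c × step c ≡ nothing × output c ≡ f x
  where open Machine M

-- Coefficient lists, constant term first.

evalPoly : List ℕ → ℕ → ℕ
evalPoly []      n = 0
evalPoly (c ∷ p) n = c + n * evalPoly p n

PolynomialTime : (Str → Str) → Set₁
PolynomialTime f =
  Σ[ M ∈ Machine ] ∃[ t ] (Computes f InTime t By M) ×
  ∃[ p ] ∀ x → t x ℕ.≤ evalPoly p (length x)

-- The nonnegative rationals below t^ε, for ε > 0.  Here
-- t^ε = sup { t^(a/b) : a/b rational, 0 < a/b < ε }, and for r ≥ 0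
-- r ≤ t^(a/b)  iff  r^b ≤ t^a.

BelowPower : ℕ → ℝ → ℚ → Set
BelowPower t ε r = 0ℚ ℚ.≤ r ×
  ∃[ δ ] 0ℚ ℚ.< δ × δ <ℝ ε × r ^ℚ (↧ₙ δ) ℚ.≤ + (t ^ ℤ.∣ ↥ δ ∣) / 1

-- w · r / |x|, where the empty string is excluded from the sum.

term : (w r : Str → ℚ) → Str → ℚ
term w r []        = 0ℚ
term w r x@(_ ∷ _) = w x ℚ.* r x ℚ.* (+ 1 / length x)

sumOver : List Str → (Str → ℚ) → ℚ
sumOver xs f = foldr ℚ._+_ 0ℚ (map f xs)

-- A series of nonnegative reals converges iff its sums over finite sets are
-- bounded; a real number is bounded by C iff its rational approximations from
-- below are.

PolynomialOnAverage : (Str → ℕ) → Distribution → Set₁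
PolynomialOnAverage t D =
  Σ[ ε ∈ ℝ ] 0ℚ <ℝ ε ×
  ∃[ C ] ∀ (xs : List Str) → Unique xs →
    ∀ (w r : Str → ℚ) →
    (∀ x → BelowDensity D x (w x)) →
    (∀ x → BelowPower (t x) ε (r x)) →
    sumOver xs (term w r) ℚ.≤ C

AvgP : DistributionalProblem → Set₁
AvgP (f , D) =
  Σ[ M ∈ Machine ] ∃[ t ] (Computes f InTime t By M) × PolynomialOnAverage t D

data Confidence : Set where
  definitely maybe : Confidence

isMaybe : Confidence → Bool
isMaybe definitely = false
isMaybe maybe      = true

module _ {T : Set} where

  SelfKnowinglyCorrect : (Str → T × Confidence) → (Str → T) → Set
  SelfKnowinglyCorrect B g = ∀ s t → B s ≡ (t , definitely) → g s ≡ t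

  maybeInputs : (Str → T × Confidence) → ℕ → List Str
  maybeInputs B n = filterᵇ (isMaybe ∘ proj₂ ∘ B) (strings n)

  maybeFraction : (Str → T × Confidence) → ℕ → ℚ
  maybeFraction B n =
    (+ length (maybeInputs B n) / length (strings n)) {{strings-nonempty n}}

  FrequentlySelfKnowinglyCorrect : (Str → T × Confidence) → (Str → T) → Set
  FrequentlySelfKnowinglyCorrect B g =
    SelfKnowinglyCorrect B g ×
    (∀ δ → 0ℚ ℚ.< δ →
      ∃[ N ] ∀ n → N ℕ.≤ n → ℚ.∣ maybeFraction B n ℚ.- 0ℚ ∣ ℚ.< δ)

-- A machine writes a pair in Σ* × {definitely, maybe} as a string.

encode : Str × Confidence → Str
encode (y , definitely) = true ∷ y
encode (y , maybe)      = false ∷ y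

HasFrequentlySelfKnowinglyCorrectPolynomialTimeAlgorithm : (Str → Str) → Set₁
HasFrequentlySelfKnowinglyCorrectPolynomialTimeAlgorithm f =
  ∃[ B ] FrequentlySelfKnowinglyCorrect B f × PolynomialTime (encode ∘ B)

{-# OPTIONS --safe #-}

-- Let the time t of a machine for f satisfy Σ μ′(x) t(x)^ε / |x| ≤ C, and let
-- 0 < a/b < ε.  The new machine runs M against a clock of (1+n)^(2+4b) − 1
-- ticks, where n = |x|, and answers "maybe" when the clock runs out.  Then
-- t(x)^(a/b) ≥ (1+n)^4 ≥ n(1+n)^3 and μ′(x) > 1/((1+n)²2ⁿ), so x contributes at
-- least (1+n)/2ⁿ to the sum.  Hence at most C·2ⁿ/(1+n) strings of length n
-- are answered "maybe".

module Submission where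

open import Defs
open import Data.Bool.Base using (Bool; true; false; not; if_then_else_; T)
open import Data.Bool.Properties using (T?)
open import Data.Fin.Base using (Fin)
open import Data.Fin.Patterns using (0F; 1F; 2F; 3F; 4F)
open import Data.Fin.Properties using (1↔⊤; 2↔Bool; +↔⊎; *↔×)
open import Data.Integer.Base as ℤ using (+_; -[1+_])
import Data.Integer.Properties as ℤ
open import Data.List.Base as List
  using (List; []; _∷_; _++_; length; map; replicate; filterᵇ; _ʳ++_)
import Data.List.Properties as List
open import Data.List.Membership.Propositional.Properties using (∈-map⁻)
open import Data.List.Relation.Binary.Disjoint.Propositional using (Disjoint)
open import Data.List.Relation.Unary.All as All using (All; []; _∷_)
import Data.List.Relation.Unary.All.Properties as All
open import Data.List.Relation.Unary.AllPairs using ([]; _∷_)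
open import Data.List.Relation.Unary.Unique.Propositional using (Unique)
import Data.List.Relation.Unary.Unique.Propositional.Properties as Unique
open import Data.Maybe.Base as Maybe using (Maybe; just; nothing)
open import Data.Nat.Base as ℕ
  using (ℕ; zero; suc; _+_; _*_; _^_; _⊓_; z≤n; s≤s; NonZero)
import Data.Nat.Properties as ℕ
open import Data.Nat.Solver using (module +-*-Solver)
open import Data.Product.Base using (∃-syntax; _×_; _,_; proj₁; proj₂)
open import Data.Product.Function.NonDependent.Propositional using (_×-↔_)
open import Data.Rational.Base as ℚ using (ℚ; 0ℚ; 1ℚ; _/_; ↧ₙ_; ↥_)
import Data.Rational.Properties as ℚ
import Data.Rational.Unnormalised.Base as ℚᵘ
import Data.Rational.Unnormalised.Properties as ℚᵘ
open import Data.Sum.Base using (_⊎_; inj₁; inj₂)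
open import Data.Sum.Function.Propositional using (_⊎-↔_)
open import Data.Unit.Base using (tt)
open import Data.Vec.Base as Vec using (Vec; []; _∷_)
import Data.Vec.Properties as Vec
open import Data.Vec.Relation.Binary.Pointwise.Inductive as Pointwise using (Pointwise; []; _∷_)
open import Function.Base using (_∘_)
open import Function.Bundles using (mk↔ₛ′; Equivalence)
open import Function.Properties.Inverse using (↔-refl; ↔-sym; ↔-trans)
open import Relation.Binary.PropositionalEquality
open import Relation.Nullary using (Dec; yes; no)
open +-*-Solver using (solve; _:+_; _:*_; con; _:=_)

-- Finite sets and vectors.

⊎-finite : ∀ {A B} → Finite A → Finite B → Finite (A ⊎ B)
⊎-finite (m , f) (n , g) = m + n , ↔-trans (f ⊎-↔ g) (↔-sym +↔⊎)

×-finite : ∀ {A B} → Finite A → Finite B → Finite (A × B)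
×-finite (m , f) (n , g) = m * n , ↔-trans (f ×-↔ g) (↔-sym *↔×)

Vec-finite : ∀ {A} → Finite A → ∀ k → Finite (Vec A k)
Vec-finite _ zero = 1 , ↔-trans
  (mk↔ₛ′ (λ _ → tt) (λ _ → []) (λ _ → refl) (λ { [] → refl })) (↔-sym 1↔⊤)
Vec-finite f (suc k) with ×-finite f (Vec-finite f k)
... | n , g = n , ↔-trans
  (mk↔ₛ′ Vec.uncons (λ (x , xs) → x ∷ xs) (λ _ → refl) (λ { (_ ∷ _) → refl })) g

take-++ : ∀ {A : Set} {m n} (xs : Vec A m) (ys : Vec A n) → Vec.take m (xs Vec.++ ys) ≡ xs
take-++ []       ys = refl
take-++ (x ∷ xs) ys = cong (x ∷_) (take-++ xs ys)

drop-++ : ∀ {A : Set} {m n} (xs : Vec A m) (ys : Vec A n) → Vec.drop m (xs Vec.++ ys) ≡ ys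
drop-++ []       ys = refl
drop-++ (x ∷ xs) ys = drop-++ xs ys

replicate-++ : ∀ {A : Set} m {n} (x : A) →
  Vec.replicate m x Vec.++ Vec.replicate n x ≡ Vec.replicate (m + n) x
replicate-++ zero    x = refl
replicate-++ (suc m) x = cong (x ∷_) (replicate-++ m x)

-- The full reading of an odometer with `k` digits in base 1+n, least significant digit first and
-- every digit equal to n. The recursion avoids subtraction and has the shape of the equation in
-- `Clock`.
ticks : ℕ → ℕ → ℕ
ticks zero    n = 0
ticks (suc k) n = n + suc n * ticks k n

suc-ticks : ∀ k n → suc (ticks k n) ≡ suc n ^ k
suc-ticks zero    n = refl
suc-ticks (suc k) n = trans (sym (ℕ.*-suc (suc n) (ticks k n))) (cong (suc n *_) (suc-ticks k n))

-- Tapes up to trailing blanks, and the odometer.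

module _ {A : Set} where

  infix 4 _∼_ _≈_

  -- Equality of half-tapes: lists agreeing up to trailing blanks.

  data _∼_ : List (Symbol A) → List (Symbol A) → Set where
    []     : [] ∼ []
    _∷_    : ∀ s {l l′} → l ∼ l′ → s ∷ l ∼ s ∷ l′
    blankˡ : ∀ {l} → [] ∼ l → [] ∼ blank ∷ l
    blankʳ : ∀ {l} → l ∼ [] → blank ∷ l ∼ []

  ∼-refl : ∀ {l} → l ∼ l
  ∼-refl {[]}    = []
  ∼-refl {s ∷ l} = s ∷ ∼-refl

  ++-blank : ∀ l → l ++ blank ∷ [] ∼ l
  ++-blank []      = blankʳ []
  ++-blank (s ∷ l) = s ∷ ++-blank l

  -- `move` writes out a blank when the head leaves a list, so `blank ∷ []` appears where a
  -- half-tape equivalent to `[]` was expected.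
  blank∷[]∼ : ∀ {l} → [] ∼ l → blank ∷ [] ∼ l
  blank∷[]∼ []         = blankʳ []
  blank∷[]∼ (blankˡ p) = blank ∷ p

  record _≈_ (t t′ : Tape A) : Set where
    constructor tape≈
    field
      before≈  : Tape.before t ∼ Tape.before t′
      current≡ : Tape.current t ≡ Tape.current t′
      after≈   : Tape.after t ∼ Tape.after t′

  ≈-refl : ∀ {t} → t ≈ t
  ≈-refl = tape≈ ∼-refl refl ∼-refl

  move-cong : ∀ m {t t′} → t ≈ t′ → move m t ≈ move m t′
  move-cong left  (tape≈ []         refl q)  = tape≈ [] refl (_ ∷ q)
  move-cong left  (tape≈ (s ∷ p)    refl q)  = tape≈ p refl (_ ∷ q)
  move-cong left  (tape≈ (blankˡ p) refl q)  = tape≈ p refl (_ ∷ q)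
  move-cong left  (tape≈ (blankʳ p) refl q)  = tape≈ p refl (_ ∷ q)
  move-cong stay  p                          = p
  move-cong right (tape≈ p refl [])          = tape≈ (_ ∷ p) refl []
  move-cong right (tape≈ p refl (s ∷ q))     = tape≈ (_ ∷ p) refl q
  move-cong right (tape≈ p refl (blankˡ q))  = tape≈ (_ ∷ p) refl q
  move-cong right (tape≈ p refl (blankʳ q))  = tape≈ (_ ∷ p) refl q

  act-cong : ∀ a {t t′} → t ≈ t′ → act a t ≈ act a t′
  act-cong (s , m) (tape≈ p _ q) = move-cong m (tape≈ p refl q)

  infix 4 _≋_

  _≋_ : ∀ {n} → Vec (Tape A) n → Vec (Tape A) n → Set
  _≋_ = Pointwise _≈_

  ≋-current : ∀ {n} {ts ts′ : Vec (Tape A) n} → ts ≋ ts′ →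
    Vec.map Tape.current ts ≡ Vec.map Tape.current ts′
  ≋-current []       = refl
  ≋-current (p ∷ ps) = cong₂ _∷_ (_≈_.current≡ p) (≋-current ps)

  ≋-act : ∀ {n} (as : Vec _ n) {ts ts′} → ts ≋ ts′ → Vec.zipWith act as ts ≋ Vec.zipWith act as ts′
  ≋-act []       []       = []
  ≋-act (a ∷ as) (p ∷ ps) = act-cong a p ∷ ≋-act as ps

  ≋-refl : ∀ {n} {ts : Vec (Tape A) n} → ts ≋ ts
  ≋-refl = Pointwise.refl ≈-refl

  leadingBits-cong : ∀ {l l′} → l ∼ l′ → leadingBits l ≡ leadingBits l′
  leadingBits-cong []             = refl
  leadingBits-cong (blank   ∷ p)  = refl
  leadingBits-cong (bit b   ∷ p)  = cong (b ∷_) (leadingBits-cong p)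
  leadingBits-cong (aux a   ∷ p)  = refl
  leadingBits-cong (blankˡ p)     = refl
  leadingBits-cong (blankʳ p)     = refl

  hold : ∀ {n} → Vec (Symbol A) n → Vec (Symbol A × Move) n
  hold = Vec.map (_, stay)

  act-hold : ∀ {n} (ts : Vec (Tape A) n) →
    Vec.zipWith act (hold (Vec.map Tape.current ts)) ts ≡ ts
  act-hold []       = refl
  act-hold (t ∷ ts) = cong (t ∷_) (act-hold ts)

  -- The tape whose head stands on the first symbol of y, with l to its left.

  at : List (Symbol A) → Str → Tape A
  at l []      = tape l blank []
  at l (b ∷ y) = tape l (bit b) (map bit y)

  load≡at : ∀ y → load y ≡ at [] y
  load≡at []      = refl
  load≡at (b ∷ y) = refl

  at-right : ∀ l b y → move right (at l (b ∷ y)) ≡ at (bit b ∷ l) y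
  at-right l b []      = refl
  at-right l b (c ∷ y) = refl

  -- The tape whose head stands on the first symbol of u, which is read leftwards.

  back : Str → List (Symbol A) → Tape A
  back []      r = tape [] blank r
  back (b ∷ u) r = tape (map bit u) (bit b) r

  back-left : ∀ u s r → move left (tape (map bit u) s r) ≡ back u (s ∷ r)
  back-left []      s r = refl
  back-left (b ∷ u) s r = refl

  -- Scanning and rewinding write out the blanks on both sides of the input, so the restored tape is
  -- the loaded one only up to `≈`. For this reason the simulation is followed up to `≋`.
  restored≈load : ∀ x → move right (tape [] blank (map bit x ++ blank ∷ [])) ≈ load x
  restored≈load []      = tape≈ (blankʳ []) refl []
  restored≈load (b ∷ x) = tape≈ (blankʳ []) refl (++-blank (map bit x))

  -- An odometer.  Each digit is a tape carrying a block of n marks, swept in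
  -- the direction given by a bit of the state: its value is the number of
  -- marks from the head to the end of the block.  Running off the block, a
  -- digit reverses its direction, which resets it to n, and the next digit is
  -- decremented.

  mark : Symbol A
  mark = bit true

  direction : Bool → Move
  direction false = left
  direction true  = right

  ahead behind : Bool → Tape A → List (Symbol A)
  ahead  false (tape l s r) = s ∷ l
  ahead  true  (tape l s r) = s ∷ r
  behind false (tape l s r) = r
  behind true  (tape l s r) = l

  record Digit (d : Bool) (v w : ℕ) (t : Tape A) : Set where
    constructor digit
    field
      ahead∼  : ahead d t ∼ replicate v mark
      behind∼ : behind d t ∼ replicate w mark

  digit-mark : ∀ {d v w t} → Digit d (suc v) w t → Tape.current t ≡ mark
  digit-mark {false} {t = tape l .mark r} (digit (.mark ∷ p) q) = refl
  digit-mark {true}  {t = tape l .mark r} (digit (.mark ∷ p) q) = refl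

  digit-blank : ∀ {d w t} → Digit d 0 w t → Tape.current t ≡ blank
  digit-blank {false} {t = tape l .blank r} (digit (blankʳ p) q) = refl
  digit-blank {true}  {t = tape l .blank r} (digit (blankʳ p) q) = refl

  digit-advance : ∀ {d v w t} → Digit d (suc v) w t →
    Digit d v (suc w) (act (mark , direction d) t)
  digit-advance {false} {t = tape []      .mark r} (digit (_ ∷ p) q) = digit (blank∷[]∼ p) (mark ∷ q)
  digit-advance {false} {t = tape (_ ∷ _) .mark r} (digit (_ ∷ p) q) = digit p (mark ∷ q)
  digit-advance {true}  {t = tape l .mark []}      (digit (_ ∷ p) q) = digit (blank∷[]∼ p) (mark ∷ q)
  digit-advance {true}  {t = tape l .mark (_ ∷ _)} (digit (_ ∷ p) q) = digit p (mark ∷ q)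

  -- The head steps back onto the block it has just crossed: the `w` marks behind it become the
  -- marks ahead, and only blanks remain behind.
  digit-reverse : ∀ {d w t} → Digit d 0 w t →
    Digit (not d) w 0 (act (blank , direction (not d)) t)
  digit-reverse {false} {t = tape l s []}      (digit (blankʳ p) q) = digit (blank∷[]∼ q) (blankʳ p)
  digit-reverse {false} {t = tape l s (_ ∷ _)} (digit (blankʳ p) q) = digit q (blankʳ p)
  digit-reverse {true}  {t = tape []      s r} (digit (blankʳ p) q) = digit (blank∷[]∼ q) (blankʳ p)
  digit-reverse {true}  {t = tape (_ ∷ _) s r} (digit (blankʳ p) q) = digit q (blankʳ p)

  -- Decrement with borrow. Each digit needs only its direction and its scanned symbol to know
  -- whether it is zero, so a borrow through all digits still takes one machine step. `nothing`
  -- means that the borrow passed the last digit.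
  tick : ∀ {k} → Vec Bool k → Vec (Symbol A) k → Maybe (Vec Bool k × Vec (Symbol A × Move) k)
  tick []       []           = nothing
  tick (d ∷ ds) (blank ∷ ss) =
    Maybe.map (λ (ds′ , as) → not d ∷ ds′ , (blank , direction (not d)) ∷ as) (tick ds ss)
  tick (d ∷ ds) (s ∷ ss)     = just (d ∷ ds , (s , direction d) ∷ hold ss)

  -- The reading `U` is tied to the digits by an equation instead of being a computed index, so that
  -- proofs can match on `0` and `suc U`.
  data Clock (n : ℕ) : ∀ {k} → ℕ → Vec Bool k → Vec (Tape A) k → Set where
    []   : Clock n 0 [] []
    cons : ∀ {k U V v w d t} {ds : Vec Bool k} {ts} →
           v + w ≡ n → U ≡ v + suc n * V → Digit d v w t → Clock n V ds ts →
           Clock n U (d ∷ ds) (t ∷ ts)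

  tick-zero : ∀ {n k} {ds : Vec Bool k} {ts} → Clock n 0 ds ts →
    tick ds (Vec.map Tape.current ts) ≡ nothing
  tick-zero [] = refl
  tick-zero {n} (cons {V = zero} {v = zero} e u D C)
    rewrite digit-blank D | tick-zero C = refl

  tick-suc : ∀ {n k U} {ds : Vec Bool k} {ts} → Clock n (suc U) ds ts →
    ∃[ ds′ ] ∃[ as ] tick ds (Vec.map Tape.current ts) ≡ just (ds′ , as) ×
                     Clock n U ds′ (Vec.zipWith act as ts)
  tick-suc (cons {v = suc v} {w} {d} {ds = ds} {ts} e u D C) rewrite digit-mark D =
    _ , _ , refl ,
    cons (trans (ℕ.+-suc v w) e) (ℕ.suc-injective u) (digit-advance D)
      (subst (Clock _ _ ds) (sym (act-hold ts)) C)
  tick-suc {n} (cons {V = zero} {zero} {w} {d} e u D C) with () ← trans u (ℕ.*-zeroʳ n)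
  tick-suc {n} (cons {V = suc V} {zero} e u D C) with tick-suc C
  ... | ds′ , as , eq , C′ rewrite digit-blank D | eq =
    _ , _ , refl ,
    -- Borrow: (1+n)(1+V) - 1 = n + (1+n)V, and the reversed digit shows `w`, which is n because `v`
    -- is zero.
    cons (trans (ℕ.+-identityʳ _) e)
      (ℕ.suc-injective (trans u (trans (ℕ.*-suc (suc n) V)
        (cong (λ m → suc m + suc n * V) (sym e)))))
      (digit-reverse D) C′

  marked : ℕ → Tape A
  marked n = tape (replicate n mark) blank []

  marked-digit : ∀ n → Digit false n 0 (move left (marked n))
  marked-digit zero    = digit (blankʳ []) (blankʳ [])
  marked-digit (suc n) = digit ∼-refl (blankʳ [])

  clock-initial : ∀ k n →
    Clock n (ticks k n) (Vec.replicate k false) (Vec.replicate k (move left (marked n)))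
  clock-initial zero    n = []
  clock-initial (suc k) n = cons (ℕ.+-identityʳ n) refl (marked-digit n) (clock-initial k n)

map-just⁻ : ∀ {A B : Set} {f : A → B} (x : Maybe A) {b} → Maybe.map f x ≡ just b →
  ∃[ a ] x ≡ just a × f a ≡ b
map-just⁻ (just a) refl = a , refl , refl

map-nothing⁻ : ∀ {A B : Set} {f : A → B} (x : Maybe A) → Maybe.map f x ≡ nothing → x ≡ nothing
map-nothing⁻ nothing _ = refl

-- Runs and halting of a machine.

module Runs (M : Machine) where
  open Machine M

  -- A record rather than a bare equation, so that both configurations can be inferred from the
  -- type.
  record _⟶_ (c c′ : Config) : Set where
    constructor steps
    field step≡ : step c ≡ just c′

  infixr 5 _∷_

  data Run : ℕ → Config → Config → Set where
    []  : ∀ {c} → Run 0 c c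
    _∷_ : ∀ {n c c′ c″} → c ⟶ c′ → Run n c′ c″ → Run (suc n) c c″

  _⊕_ : ∀ {m n c c′ c″} → Run m c c′ → Run n c′ c″ → Run (m + n) c c″
  []      ⊕ ss = ss
  (r ∷ rs) ⊕ ss = r ∷ (rs ⊕ ss)

  run≡ : ∀ {n c c′} → Run n c c′ → run n c ≡ just c′
  run≡ []             = refl
  run≡ (steps p ∷ rs) rewrite p = run≡ rs

  record Halts (n : ℕ) (c : Config) (y : Str) : Set where
    constructor halts
    field
      {final} : Config
      reaches : Run n c final
      stops   : step final ≡ nothing
      outputs : output final ≡ y

  later : ∀ {m n c c′ y} → Run m c c′ → Halts n c′ y → Halts (m + n) c y
  later r (halts s h o) = halts (r ⊕ s) h o

-- The clocked machine.

module Clocked (M : Machine) (k : ℕ) where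
  open Machine M

  Control : Set
  Control = Fin 5 ⊎ (State × Vec Bool k)

  pattern scan          = inj₁ 0F
  pattern rewind        = inj₁ 1F
  pattern finish-maybe  = inj₁ 2F
  pattern finish-def    = inj₁ 3F
  pattern done          = inj₁ 4F
  pattern simulate q ds = inj₂ (q , ds)

  S : Set
  S = Symbol Aux

  Action : Set
  Action = Control × Vec (S × Move) (suc extraTapes) × Vec (S × Move) k

  -- On either outcome tape zero moves one cell to the left, where the
  -- confidence bit is then written; after a timeout its old cell is blanked,
  -- which leaves the bit as the whole output.

  simulation : Maybe (State × Vec (S × Move) (suc extraTapes)) → Maybe (Vec Bool k × Vec (S × Move) k) →
               Vec S (suc extraTapes) → Vec S k → Action
  simulation nothing         _                 (s ∷ ms) cs = finish-def , (s , left) ∷ hold ms , hold cs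
  simulation (just _)        nothing           (_ ∷ ms) cs =
    finish-maybe , (blank , left) ∷ hold ms , hold cs
  simulation (just (q , as)) (just (ds , bs))  _        _  = simulate q ds , as , bs

  -- While scanning, each clock tape receives one mark per input bit, so every block gets length
  -- |x|. The last scanning step moves all clock heads left onto their blocks; hence the odometer
  -- starts full, with all directions `false`.
  action : Control → Vec S (suc extraTapes) → Vec S k → Maybe Action
  action scan            (bit b ∷ ms) cs =
    just (scan , (bit b , right) ∷ hold ms , Vec.replicate k (mark , right))
  action scan            (s     ∷ ms) cs =
    just (rewind , (s , left) ∷ hold ms , Vec.replicate k (blank , left))
  action rewind          (bit b ∷ ms) cs = just (rewind , (bit b , left) ∷ hold ms , hold cs)
  action rewind          (s     ∷ ms) cs =
    just (simulate start (Vec.replicate k false) , (s , right) ∷ hold ms , hold cs)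
  action finish-maybe    (_     ∷ ms) cs = just (done , (bit false , stay) ∷ hold ms , hold cs)
  action finish-def      (_     ∷ ms) cs = just (done , (bit true , stay) ∷ hold ms , hold cs)
  action done            _            _  = nothing
  action (simulate q ds) ms           cs = just (simulation (δ q ms) (tick ds cs) ms cs)

  clocked : Machine
  clocked = record
    { State        = Control
    ; Aux          = Aux
    ; state-finite = ⊎-finite (5 , ↔-refl) (×-finite state-finite (Vec-finite (2 , ↔-sym 2↔Bool) k))
    ; aux-finite   = aux-finite
    ; extraTapes   = extraTapes + k
    ; start        = scan
    ; δ            = λ q ss → Maybe.map (λ (q′ , as , bs) → q′ , as Vec.++ bs)
                       (action q (Vec.take (suc extraTapes) ss) (Vec.drop (suc extraTapes) ss))
    }

  module C = Machine clocked
  open Runs clocked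

  config : Control → Vec (Tape Aux) (suc extraTapes) → Vec (Tape Aux) k → C.Config
  config q ts us = q , ts Vec.++ us

  currents : ∀ {n} → Vec (Tape Aux) n → Vec S n
  currents = Vec.map Tape.current

  merge : Vec (Tape Aux) (suc extraTapes) → Vec (Tape Aux) k → Action → C.Config
  merge ts us (q , as , bs) = config q (Vec.zipWith act as ts) (Vec.zipWith act bs us)

  -- Separates the tapes of `M` from the clock tapes, so that later arguments need not deal with the
  -- concatenated vector.
  step-config : ∀ q ts us →
    C.step (config q ts us) ≡ Maybe.map (merge ts us) (action q (currents ts) (currents us))
  step-config q ts us
    rewrite Vec.map-++ Tape.current ts us
          | take-++ (currents ts) (currents us)
          | drop-++ (currents ts) (currents us)
    with action q (currents ts) (currents us)
  ... | nothing            = refl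
  ... | just (q′ , as , bs) = cong (λ v → just (q′ , v)) (Vec.zipWith-++ act as bs ts us)

  step-just : ∀ q ts us {a} → action q (currents ts) (currents us) ≡ just a →
    config q ts us ⟶ merge ts us a
  step-just q ts us p = steps (trans (step-config q ts us) (cong (Maybe.map (merge ts us)) p))

  -- For the steps that change only tape zero and the clock. The new tapes enter through equations,
  -- so that they can be given in the form the next step expects.
  step-tape₀ : ∀ q t ts us {q′ a bs t′ us′} →
    action q (currents (t ∷ ts)) (currents us) ≡ just (q′ , a ∷ hold (currents ts) , bs) →
    act a t ≡ t′ → Vec.zipWith act bs us ≡ us′ →
    config q (t ∷ ts) us ⟶ config q′ (t′ ∷ ts) us′
  step-tape₀ q t ts us p refl refl = subst
    (λ v → config q (t ∷ ts) us ⟶ config _ (_ ∷ v) _) (act-hold ts) (step-just q (t ∷ ts) us p)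

  -- Start-up: measuring the input and rewinding.

  -- Induction on the unread part `y`; `u` is the part already read, nearest symbol first, and its
  -- length is the number of marks written.
  run-scan : ∀ u y ts →
    Run (suc (length y)) (config scan (at (map bit u) y ∷ ts) (Vec.replicate k (marked (length u))))
      (config rewind (back (y ʳ++ u) (blank ∷ []) ∷ ts)
                     (Vec.replicate k (move left (marked (length (y ʳ++ u))))))
  run-scan u [] ts =
    step-tape₀ scan (tape (map bit u) blank []) ts _ refl (back-left u blank [])
      (Vec.zipWith-replicate act (blank , left) (marked (length u))) ∷ []
  run-scan u (b ∷ y) ts =
    step-tape₀ scan (at (map bit u) (b ∷ y)) ts _ refl (at-right (map bit u) b y)
      (Vec.zipWith-replicate act (mark , right) (marked (length u))) ∷
    run-scan (b ∷ u) y ts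

  run-rewind : ∀ u r ts us →
    Run (suc (length u)) (config rewind (back u r ∷ ts) us)
      (config (simulate start (Vec.replicate k false))
              (move right (tape [] blank (map bit u ʳ++ r)) ∷ ts) us)
  run-rewind []      r ts us = step-tape₀ rewind (tape [] blank r) ts us refl refl (act-hold us) ∷ []
  run-rewind (b ∷ u) r ts us =
    step-tape₀ rewind (back (b ∷ u) r) ts us refl (back-left u (bit b) r) (act-hold us) ∷
    run-rewind u (bit b ∷ r) ts us

  blanks : Vec (Tape Aux) extraTapes
  blanks = Vec.replicate extraTapes (load [])

  -- Each of the two passes takes n steps on bits and one on the bounding blank.
  startup : ℕ → ℕ
  startup n = suc n + suc n

  restored : Str → Tape Aux
  restored x = move right (tape [] blank (map bit x ++ blank ∷ []))

  run-startup : ∀ x →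
    Run (startup (length x)) (C.initial x)
      (config (simulate start (Vec.replicate k false)) (restored x ∷ blanks)
              (Vec.replicate k (move left (marked (length x)))))
  run-startup x =
    subst (λ c → Run (suc n) c (config rewind (back y (blank ∷ []) ∷ blanks) (clock (length y))))
      (sym initial≡) (run-scan [] x blanks) ⊕
    rewound y (trans (List.length-ʳ++ x) (ℕ.+-identityʳ n))
      -- The input is reversed once by each pass and so returns to its order, followed by the blank
      -- at which the scan stopped.
      (trans (cong (_ʳ++ blank ∷ []) (List.map-ʳ++ bit x)) (List.ʳ++-ʳ++ (map bit x)))
    where
    n = length x
    y = x ʳ++ []
    clock : ℕ → Vec (Tape Aux) k
    clock m = Vec.replicate k (move left (marked m))
    initial≡ : C.initial x ≡ config scan (at [] x ∷ blanks) (Vec.replicate k (marked 0))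
    initial≡ = cong₂ (λ t v → scan , t ∷ v) (load≡at x) (sym (replicate-++ extraTapes (load [])))
    rewound : ∀ y {m r} → length y ≡ m → map bit y ʳ++ blank ∷ [] ≡ r →
      Run (suc m) (config rewind (back y (blank ∷ []) ∷ blanks) (clock (length y)))
        (config (simulate start (Vec.replicate k false))
                (move right (tape [] blank r) ∷ blanks) (clock m))
    rewound y refl refl = run-rewind y (blank ∷ []) blanks (clock (length y))

  -- Simulation against the clock.

  step-done : ∀ ts us → C.step (config done ts us) ≡ nothing
  step-done ts us = step-config done ts us

  halts-finish-def : ∀ t ts us →
    Halts 1 (config finish-def (t ∷ ts) us) (true ∷ leadingBits (Tape.after t))
  halts-finish-def t ts us = halts
    (step-tape₀ finish-def t ts us refl refl (act-hold us) ∷ [])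
    (step-done (act (bit true , stay) t ∷ ts) us) refl

  halts-finish-maybe : ∀ t ts us →
    Halts 1 (config finish-maybe (t ∷ ts) us) (false ∷ leadingBits (Tape.after t))
  halts-finish-maybe t ts us = halts
    (step-tape₀ finish-maybe t ts us refl refl (act-hold us) ∷ [])
    (step-done (act (bit false , stay) t ∷ ts) us) refl

  -- A transition depends only on the scanned symbols, which `≋` preserves, so `M` moves alike on
  -- both sets of tapes.
  δ-just : ∀ q {ts ts′ c} → ts′ ≋ ts → step (q , ts) ≡ just c →
    ∃[ as ] δ q (currents ts′) ≡ just (proj₁ c , as) × proj₂ c ≡ Vec.zipWith act as ts
  δ-just q {ts} p s with map-just⁻ (δ q (currents ts)) s
  ... | (_ , as) , d , refl = as , trans (cong (δ q) (≋-current p)) d , refl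

  δ-nothing : ∀ q {ts ts′} → ts′ ≋ ts → step (q , ts) ≡ nothing → δ q (currents ts′) ≡ nothing
  δ-nothing q {ts} p s = trans (cong (δ q) (≋-current p)) (map-nothing⁻ (δ q (currents ts)) s)

  step-simulate : ∀ q ds ts us {x y} → δ q (currents ts) ≡ x → tick ds (currents us) ≡ y →
    action (simulate q ds) (currents ts) (currents us) ≡ just (simulation x y (currents ts) (currents us))
  step-simulate q ds ts us d τ =
    cong₂ (λ x y → just (simulation x y (currents ts) (currents us))) d τ

  after-left : ∀ (s : S) t → Tape.after (act (s , left) t) ≡ s ∷ Tape.after t
  after-left s (tape []      _ r) = refl
  after-left s (tape (_ ∷ _) _ r) = refl

  -- Each simulated step uses one tick, so i ≤ U keeps the clock from expiring first. Halting takes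
  -- precedence over an expired clock, hence equality is allowed. The last two steps move left and
  -- write the confidence bit.
  simulate-halts : ∀ i {n U q ds ts ts′ us c} → ts′ ≋ ts → Clock n U ds us →
    run i (q , ts) ≡ just c → step c ≡ nothing → i ℕ.≤ U →
    Halts (i + 2) (config (simulate q ds) ts′ us) (true ∷ output c)
  simulate-halts zero {q = q} {ds} {t ∷ ts} {t′ ∷ ts′} {us} (p ∷ ps) _ refl h _ = later
    (step-tape₀ (simulate q ds) t′ ts′ us
      (step-simulate q ds (t′ ∷ ts′) us (δ-nothing q (p ∷ ps) h) refl) refl (act-hold us) ∷ [])
    (subst (λ y → Halts 1 (config finish-def (t₁ ∷ ts′) us) (true ∷ y)) out (halts-finish-def t₁ ts′ us))
    where
    t₁ = act (Tape.current t′ , left) t′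
    out : leadingBits (Tape.after t₁) ≡ leadingBits (Tape.current t ∷ Tape.after t)
    out = trans (cong leadingBits (after-left (Tape.current t′) t′))
      (trans (cong (λ s → leadingBits (s ∷ Tape.after t′)) (_≈_.current≡ p))
        (leadingBits-cong (Tape.current t ∷ _≈_.after≈ p)))
  simulate-halts (suc i) {q = q} {ds} {ts} {ts′} {us} p C r h (s≤s i≤U)
    with step (q , ts) in eq
  ... | just c₁ with δ-just q p eq | tick-suc C
  ... | as , d , refl | ds₁ , bs , τ , C₁ = later
    (step-just (simulate q ds) ts′ us (step-simulate q ds ts′ us d τ) ∷ [])
    (simulate-halts i (≋-act as p) C₁ r h i≤U)

  -- Induction on the reading. At zero, U < i still guarantees a next step of `M`, so `simulation`
  -- takes its timeout branch; the blanked cell then cuts the output off after the confidence bit.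
  simulate-timeout : ∀ U {n i q ds ts ts′ us c} → ts′ ≋ ts → Clock n U ds us →
    run i (q , ts) ≡ just c → U ℕ.< i →
    Halts (U + 2) (config (simulate q ds) ts′ us) (false ∷ [])
  simulate-timeout U {i = suc i} {q} {ts = ts} p C r U<i with step (q , ts) in eq
  simulate-timeout zero {i = suc i} {q} {ds} {ts} {t′ ∷ ts′} {us} p C r _ | just c₁
    with δ-just q p eq
  ... | _ , d , _ = later
    (step-tape₀ (simulate q ds) t′ ts′ us
      (step-simulate q ds (t′ ∷ ts′) us d (tick-zero C)) refl (act-hold us) ∷ [])
    (subst (λ y → Halts 1 (config finish-maybe (t₁ ∷ ts′) us) (false ∷ leadingBits y))
      (after-left blank t′) (halts-finish-maybe t₁ ts′ us))
    where t₁ = act (blank , left) t′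
  simulate-timeout (suc U) {i = suc i} {q} {ds} {ts} {ts′} {us} p C r (s≤s U<i) | just c₁
    with δ-just q p eq | tick-suc C
  ... | as , d , refl | ds₁ , bs , τ , C₁ = later
    (step-just (simulate q ds) ts′ us (step-simulate q ds ts′ us d τ) ∷ [])
    (simulate-timeout U (≋-act as p) C₁ r U<i)

  restored≋ : ∀ x → restored x ∷ blanks ≋ load x ∷ blanks
  restored≋ x = restored≈load x ∷ ≋-refl

  -- Correctness of the clocked answers.

  module _ (f : Str → Str) (t : Str → ℕ) (computes : Computes f InTime t By M) where

    InTime : Str → Set
    InTime x = t x ℕ.≤ ticks k (length x)

    -- The decision is an argument so that proofs can match on it.
    verdict : ∀ x → Dec (InTime x) → Str × Confidence
    verdict x (yes _) = f x , definitely
    verdict x (no  _) = [] , maybe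

    answer : Str → Str × Confidence
    answer x = verdict x (t x ℕ.≤? ticks k (length x))

    time : Str → ℕ
    time x = startup (length x) + (t x ⊓ ticks k (length x) + 2)

    clocked-halts : ∀ x (d : Dec (InTime x)) → Halts (time x) (C.initial x) (encode (verdict x d))
    clocked-halts x d with computes x
    clocked-halts x (yes t≤T) | c , r , h , o = later (run-startup x)
      (subst₂ (λ m y → Halts (m + 2) _ (true ∷ y)) (sym (ℕ.m≤n⇒m⊓n≡m t≤T)) o
        (simulate-halts (t x) (restored≋ x) (clock-initial k (length x)) r h t≤T))
    clocked-halts x (no t≰T)  | c , r , _ = later (run-startup x)
      (subst (λ m → Halts (m + 2) _ (false ∷ [])) (sym (ℕ.m≥n⇒m⊓n≡n (ℕ.≰⇒≥ t≰T)))
        (simulate-timeout (ticks k (length x)) (restored≋ x) (clock-initial k (length x)) r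
          (ℕ.≰⇒> t≰T)))

    clocked-computes : Computes (encode ∘ answer) InTime time By clocked
    clocked-computes x with clocked-halts x (t x ℕ.≤? ticks k (length x))
    ... | halts r h o = _ , run≡ r , h , o

    answer-correct : SelfKnowinglyCorrect answer f
    answer-correct x y = correct (t x ℕ.≤? ticks k (length x))
      where
      correct : ∀ d → verdict x d ≡ (y , definitely) → f x ≡ y
      correct (yes _) refl = refl

    maybe⇒slow : ∀ x → T (isMaybe (proj₂ (answer x))) → ticks k (length x) ℕ.< t x
    maybe⇒slow x = slow (t x ℕ.≤? ticks k (length x))
      where
      slow : ∀ d → T (isMaybe (proj₂ (verdict x d))) → ticks k (length x) ℕ.< t x
      slow (no t≰T) _ = ℕ.≰⇒> t≰T

-- The polynomial time bound.

-- The coefficients of a + (1+X)p, by the identity a + (1+X)(c + Xp) = (a+c) + X(c + (1+X)p).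
addLinear : ℕ → List ℕ → List ℕ
addLinear a []      = a ∷ []
addLinear a (c ∷ p) = (a + c) ∷ addLinear c p

eval-addLinear : ∀ a p n → evalPoly (addLinear a p) n ≡ a + suc n * evalPoly p n
eval-addLinear a []      n = trans (cong (ℕ._+_ a) (ℕ.*-zeroʳ n)) (cong (ℕ._+_ a) (sym (ℕ.*-zeroʳ n)))
eval-addLinear a (c ∷ p) n = trans
  (cong (λ m → a + c + n * m) (eval-addLinear c p n))
  (solve 4 (λ A C N E → A :+ C :+ N :* (C :+ (con 1 :+ N) :* E) :=
                        A :+ (con 1 :+ N) :* (C :+ N :* E)) refl a c n (evalPoly p n))

powerPoly : ℕ → List ℕ
powerPoly zero    = 1 ∷ []
powerPoly (suc j) = addLinear 0 (powerPoly j)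

eval-powerPoly : ∀ j n → evalPoly (powerPoly j) n ≡ suc n ^ j
eval-powerPoly zero    n = cong suc (ℕ.*-zeroʳ n)
eval-powerPoly (suc j) n = trans (eval-addLinear 0 (powerPoly j) n) (cong (suc n *_) (eval-powerPoly j n))

-- With N = 1+n this is 1 + 2N + N^(2+j): start-up takes 2N steps, and the clock with the two
-- finishing steps accounts for (N^(2+j) - 1) + 2.
timePoly : ℕ → List ℕ
timePoly j = addLinear 1 (addLinear 2 (powerPoly j))

time-bound : ∀ j n m → m ℕ.≤ ticks (2 + j) n →
  suc n + suc n + (m + 2) ℕ.≤ evalPoly (timePoly j) n
time-bound j n m m≤T = begin
  N + N + (m + 2)                                ≤⟨ ℕ.+-monoʳ-≤ (N + N) (ℕ.+-monoˡ-≤ 2 m≤T) ⟩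
  N + N + (ticks (2 + j) n + 2)                  ≡⟨ cong (ℕ._+_ (N + N)) (ℕ.+-suc _ 1) ⟩
  N + N + (suc (ticks (2 + j) n) + 1)            ≡⟨ cong (λ p → N + N + (p + 1)) (suc-ticks (2 + j) n) ⟩
  N + N + (N ^ (2 + j) + 1)                      ≡⟨ solve 2 (λ X P → X :+ X :+ (X :* (X :* P) :+ con 1) :=
                                                   con 1 :+ X :* (con 2 :+ X :* P)) refl N (N ^ j) ⟩
  1 + N * (2 + N * N ^ j)                        ≡⟨ cong (λ p → 1 + N * (2 + N * p)) (eval-powerPoly j n) ⟨
  1 + N * (2 + N * evalPoly (powerPoly j) n)     ≡⟨ cong (λ p → 1 + N * p) (eval-addLinear 2 (powerPoly j) n) ⟨
  1 + N * evalPoly (addLinear 2 (powerPoly j)) n ≡⟨ eval-addLinear 1 (addLinear 2 (powerPoly j)) n ⟨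
  evalPoly (timePoly j) n                        ∎
  where
  open ℕ.≤-Reasoning
  N = suc n

-- Arithmetic of fractions.

toℚᵘ-/ : ∀ a b .{{_ : NonZero b}} → ℚ.toℚᵘ (+ a / b) ℚᵘ.≃ (+ a ℚᵘ./ b)
toℚᵘ-/ a (suc b) = ℚ.toℚᵘ-fromℚᵘ (ℚᵘ.mkℚᵘ (+ a) b)

/-mono-≤ : ∀ {a b c d} .{{_ : NonZero b}} .{{_ : NonZero d}} →
  a * d ℕ.≤ c * b → + a / b ℚ.≤ + c / d
/-mono-≤ {a} {b@(suc _)} {c} {d@(suc _)} h = ℚ.toℚᵘ-cancel-≤
  (ℚᵘ.≤-respˡ-≃ (ℚᵘ.≃-sym (toℚᵘ-/ a b)) (ℚᵘ.≤-respʳ-≃ (ℚᵘ.≃-sym (toℚᵘ-/ c d))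
    (ℚᵘ.*≤* (subst₂ ℤ._≤_ (ℤ.pos-* a d) (ℤ.pos-* c b) (ℤ.+≤+ h)))))

/-cancel-≤ : ∀ {a b c d} .{{_ : NonZero b}} .{{_ : NonZero d}} →
  + a / b ℚ.≤ + c / d → a * d ℕ.≤ c * b
/-cancel-≤ {a} {b@(suc _)} {c} {d@(suc _)} h = ℤ.drop‿+≤+
  (subst₂ ℤ._≤_ (sym (ℤ.pos-* a d)) (sym (ℤ.pos-* c b))
    (ℚᵘ.drop-*≤* (ℚᵘ.≤-respˡ-≃ (toℚᵘ-/ a b) (ℚᵘ.≤-respʳ-≃ (toℚᵘ-/ c d) (ℚ.toℚᵘ-mono-≤ h)))))

/-mono-< : ∀ {a b c d} .{{_ : NonZero b}} .{{_ : NonZero d}} →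
  a * d ℕ.< c * b → + a / b ℚ.< + c / d
/-mono-< {a} {b} {c} {d} h = ℚ.≰⇒> λ c/d≤a/b → ℕ.<⇒≱ h (/-cancel-≤ {c} {d} {a} {b} c/d≤a/b)

/-≡ : ∀ {a b c d} .{{_ : NonZero b}} .{{_ : NonZero d}} →
  a * d ≡ c * b → + a / b ≡ + c / d
/-≡ {a} {b} {c} {d} h = ℚ.≤-antisym (/-mono-≤ {a} {b} {c} {d} (ℕ.≤-reflexive h))
  (/-mono-≤ {c} {d} {a} {b} (ℕ.≤-reflexive (sym h)))

/-* : ∀ a b c d .{{_ : NonZero b}} .{{_ : NonZero d}} .{{_ : NonZero (b * d)}} →
  (+ a / b) ℚ.* (+ c / d) ≡ + (a * c) / (b * d)
/-* a b@(suc _) c d@(suc _) = ℚ.toℚᵘ-injective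
  (ℚᵘ.≃-trans (ℚ.toℚᵘ-homo-* (+ a / b) (+ c / d))
  (ℚᵘ.≃-trans (ℚᵘ.*-cong (toℚᵘ-/ a b) (toℚᵘ-/ c d))
  (ℚᵘ.≃-trans (ℚᵘ.*≡* (cong (ℤ._* + (b * d)) (sym (ℤ.pos-* a c))))
  (ℚᵘ.≃-sym (toℚᵘ-/ (a * c) (b * d))))))

/-+ : ∀ a c d .{{_ : NonZero d}} → (+ a / d) ℚ.+ (+ c / d) ≡ + (a + c) / d
/-+ a c d@(suc _) = ℚ.toℚᵘ-injective
  (ℚᵘ.≃-trans (ℚ.toℚᵘ-homo-+ (+ a / d) (+ c / d))
  (ℚᵘ.≃-trans (ℚᵘ.+-cong (toℚᵘ-/ a d) (toℚᵘ-/ c d))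
  (ℚᵘ.≃-trans (ℚᵘ.*≡* eq) (ℚᵘ.≃-sym (toℚᵘ-/ (a + c) d)))))
  where
  eq : (+ a ℤ.* + d ℤ.+ + c ℤ.* + d) ℤ.* + d ≡ + (a + c) ℤ.* + (d * d)
  eq = begin
    (+ a ℤ.* + d ℤ.+ + c ℤ.* + d) ℤ.* + d ≡⟨ cong (ℤ._* + d) (ℤ.*-distribʳ-+ (+ d) (+ a) (+ c)) ⟨
    ((+ a ℤ.+ + c) ℤ.* + d) ℤ.* + d       ≡⟨ ℤ.*-assoc (+ (a + c)) (+ d) (+ d) ⟩
    + (a + c) ℤ.* (+ d ℤ.* + d)           ≡⟨ cong (+ (a + c) ℤ.*_) (ℤ.pos-* d d) ⟨
    + (a + c) ℤ.* + (d * d)               ∎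
    where open ≡-Reasoning

/1-^ : ∀ m b → (+ m / 1) ^ℚ b ≡ + (m ^ b) / 1
/1-^ m zero    = refl
/1-^ m (suc b) = trans (cong ((+ m / 1) ℚ.*_) (/1-^ m b)) (/-* m 1 (m ^ b) 1)

-- Serves to replace the rational bound `C` on the sums by a natural number.
≤-numerator : ∀ p → p ℚ.≤ + ℤ.∣ ↥ p ∣ / 1
≤-numerator p = subst (ℚ._≤ + ℤ.∣ ↥ p ∣ / 1) (ℚ.↥p/↧p≡p p) (bound (↥ p) (↧ₙ p))
  where
  bound : ∀ i d .{{_ : NonZero d}} → i / d ℚ.≤ + ℤ.∣ i ∣ / 1
  bound (+ m)    d = /-mono-≤ {m} {d} {m} {1} (ℕ.*-monoʳ-≤ m (ℕ.>-nonZero⁻¹ d))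
  bound -[1+ m ] d = ℚ.<⇒≤ (ℚ.neg<pos (-[1+ m ] / d) (+ suc m / 1))
    where
    instance
      _ = ℚ.neg-pos {+ suc m / d} (ℚ.normalize-pos (suc m) d)
      _ = ℚ.normalize-pos (suc m) 1

numerator≢0 : ∀ p → .{{ℚ.Positive p}} → NonZero ℤ.∣ ↥ p ∣
numerator≢0 (ℚ.mkℚ ℤ.+[1+ _ ] _ _) = _

numerator/denominator : ∀ p → .{{ℚ.Positive p}} → + ℤ.∣ ↥ p ∣ / ↧ₙ p ≡ p
numerator/denominator p@(ℚ.mkℚ ℤ.+[1+ _ ] _ _) = ℚ.↥p/↧p≡p p

sumOver-constant : ∀ {m d} .{{_ : NonZero d}} (g : Str → ℚ) {xs} →
  All (λ x → g x ≡ + m / d) xs → sumOver xs g ≡ + (length xs * m) / d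
sumOver-constant {m} {d} g []               = /-≡ {0} {1} {0} {d} refl
sumOver-constant {m} {d} g {_ ∷ xs} (p ∷ ps) = trans
  (cong₂ ℚ._+_ p (sumOver-constant g ps)) (/-+ m (length xs * m) d)

-- The strings of a given length.

strings-length : ∀ n → All (λ x → length x ≡ n) (strings n)
strings-length zero    = refl ∷ []
strings-length (suc n) = All.++⁺ (All.map⁺ (All.map (cong suc) (strings-length n)))
                                 (All.map⁺ (All.map (cong suc) (strings-length n)))

length-strings : ∀ n → length (strings n) ≡ 2 ^ n
length-strings zero    = refl
length-strings (suc n) = trans
  (List.length-++ (map (false ∷_) (strings n)))
  (cong₂ _+_ (trans (List.length-map _ (strings n)) (length-strings n))
    (trans (trans (List.length-map _ (strings n)) (length-strings n)) (sym (ℕ.+-identityʳ _))))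

strings-unique : ∀ n → Unique (strings n)
strings-unique zero    = [] ∷ []
strings-unique (suc n) = Unique.++⁺
  (Unique.map⁺ List.∷-injectiveʳ (strings-unique n))
  (Unique.map⁺ List.∷-injectiveʳ (strings-unique n)) disjoint
  where
  disjoint : Disjoint (map (false ∷_) (strings n)) (map (true ∷_) (strings n))
  disjoint (p , q) with ∈-map⁻ (false ∷_) p | ∈-map⁻ (true ∷_) q
  ... | _ , _ , refl | _ , _ , ()

-- The averaging argument.

denominator : ℕ → ℕ
denominator n = suc n * suc n * 2 ^ n

2^n≢0 : ∀ n → NonZero (2 ^ n)
2^n≢0 n = ℕ.m^n≢0 2 n

denominator≢0 : ∀ n → NonZero (denominator n)
denominator≢0 n = ℕ.m*n≢0 (suc n * suc n) (2 ^ n) {{_}} {{2^n≢0 n}}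

-- The series is bounded through rationals strictly below the density, hence (1+n)² in place of
-- n(1+n). The empty string has density 0 and so needs a negative value, which `term` ignores.
weight : Str → ℚ
weight []        = ℚ.- 1ℚ
weight x@(_ ∷ _) = (+ 1 / denominator (length x)) {{denominator≢0 (length x)}}

weight<density : ∀ x → weight x ℚ.< uniformDensity x
weight<density []        = ℚ.negative⁻¹ (ℚ.- 1ℚ)
weight<density x@(_ ∷ y) = /-mono-< {1} {denominator n} {1} {n * suc n * 2 ^ n}
  (ℕ.*-monoʳ-< 1 (ℕ.*-monoˡ-< (2 ^ n) (ℕ.*-monoˡ-< (suc n) (ℕ.n<1+n n))))
  where
  n = length x
  instance
    _ = 2^n≢0 n
    _ = denominator≢0 n
    _ = ℕ.m*n≢0 (n * suc n) (2 ^ n)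

-- With this value of t(x)^ε a slow string x of length n contributes exactly
-- (1+n)/2ⁿ to the sum.
slowRate : ℕ → ℕ
slowRate n = n * suc n ^ 3

slow-term : ∀ {n} r x .{{_ : NonZero n}} → length x ≡ n → r x ≡ + slowRate n / 1 →
  term weight r x ≡ (+ suc n / 2 ^ n) {{2^n≢0 n}}
slow-term {n} r x@(_ ∷ y) refl r≡ = begin
  (+ 1 / D) ℚ.* r x ℚ.* (+ 1 / n)
    ≡⟨ cong (λ q → (+ 1 / D) ℚ.* q ℚ.* (+ 1 / n)) r≡ ⟩
  (+ 1 / D) ℚ.* (+ P / 1) ℚ.* (+ 1 / n)
    ≡⟨ cong (ℚ._* (+ 1 / n)) (/-* 1 D P 1) ⟩
  (+ (1 * P) / (D * 1)) ℚ.* (+ 1 / n)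
    ≡⟨ /-* (1 * P) (D * 1) 1 n ⟩
  + (1 * P * 1) / (D * 1 * n)
    ≡⟨ /-≡ {1 * P * 1} {D * 1 * n} {suc n} {2 ^ n}
         (solve 2 (λ M E → let N = con 1 :+ M in
           con 1 :* (M :* (N :* (N :* (N :* con 1)))) :* con 1 :* E :=
           N :* (N :* N :* E :* con 1 :* M)) refl n (2 ^ n)) ⟩
  + suc n / 2 ^ n ∎
  where
  open ≡-Reasoning
  D = denominator n
  P = slowRate n
  instance
    _ = 2^n≢0 n
    _ = denominator≢0 n
    D1≢0 = ℕ.m*n≢0 D 1
    _ = ℕ.m*n≢0 (D * 1) n

-- The conclusion is the form in which `BelowPower` expresses `slowRate n` ≤ t^(a/b). Since n(1+n)³
-- ≤ (1+n)⁴, the left side is at most t, and t ≤ t^a because t and a are positive.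
slowRate-bound : ∀ n a b t .{{_ : NonZero a}} → suc n ^ (4 * b) ℕ.≤ t → slowRate n ^ b ℕ.≤ t ^ a
slowRate-bound n (suc a) b t h = begin
  slowRate n ^ b       ≤⟨ ℕ.^-monoˡ-≤ b (ℕ.*-monoˡ-≤ (suc n ^ 3) (ℕ.n≤1+n n)) ⟩
  (suc n ^ 4) ^ b   ≡⟨ ℕ.^-*-assoc (suc n) 4 b ⟩
  suc n ^ (4 * b)   ≤⟨ h ⟩
  t                 ≡⟨ ℕ.*-identityʳ t ⟨
  t * 1             ≤⟨ ℕ.*-monoʳ-≤ t (ℕ.m^n>0 t a) ⟩
  t ^ suc a         ∎
  where
  open ℕ.≤-Reasoning
  instance
    _ = ℕ.>-nonZero (ℕ.≤-trans (ℕ.m^n>0 (suc n) (4 * b)) h)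

module Average (t : Str → ℕ) (ε : ℝ) (δ : ℚ) (0<δ : 0ℚ ℚ.< δ) (δ<ε : δ <ℝ ε)
  (slow : Str → Bool) (isSlow : ∀ x → T (slow x) → suc (length x) ^ (4 * ↧ₙ δ) ℕ.≤ t x) where

  rate : Str → ℕ
  rate x = if slow x then slowRate (length x) else 0

  rate-bound : ∀ x → rate x ^ ↧ₙ δ ℕ.≤ t x ^ ℤ.∣ ↥ δ ∣
  rate-bound x with slow x | isSlow x
  ... | true  | h = slowRate-bound (length x) ℤ.∣ ↥ δ ∣ (↧ₙ δ) (t x)
    {{numerator≢0 δ {{ℚ.positive 0<δ}}}} (h _)
  -- The denominator of `δ` is a successor, so this power of the rate 0 is 0.
  ... | false | _ = z≤n

  below : ∀ x → BelowPower (t x) ε (+ rate x / 1)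
  below x = /-mono-≤ {0} {1} {rate x} {1} z≤n , δ , 0<δ , δ<ε ,
    subst (ℚ._≤ _) (sym (/1-^ (rate x) (↧ₙ δ)))
      (/-mono-≤ {rate x ^ ↧ₙ δ} {1} {t x ^ ℤ.∣ ↥ δ ∣} {1} (ℕ.*-monoˡ-≤ 1 (rate-bound x)))

  module _ (C : ℚ) (bounded : ∀ xs → Unique xs → ∀ w r →
    (∀ x → BelowDensity standardUniform x (w x)) → (∀ x → BelowPower (t x) ε (r x)) →
    sumOver xs (term w r) ℚ.≤ C) where

    -- The bound is applied to the slow strings of length n alone. Their terms all equal (1+n)/2ⁿ,
    -- so the sum is their number times this value.
    slow-count : ∀ n .{{_ : NonZero n}} →
      length (filterᵇ slow (strings n)) * suc n ℕ.≤ ℤ.∣ ↥ C ∣ * 2 ^ n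
    slow-count n = subst (ℕ._≤ ℤ.∣ ↥ C ∣ * 2 ^ n) (ℕ.*-identityʳ _)
      (/-cancel-≤ {length xs * suc n} {2 ^ n} {ℤ.∣ ↥ C ∣} {1} (ℚ.≤-trans
        (subst (ℚ._≤ C) (sumOver-constant (term weight r) constant)
          (bounded xs (Unique.filter⁺ (T? ∘ slow) (strings-unique n)) weight r
            (λ x → Equivalence.from (standardUniform-density x (weight x)) (weight<density x)) below))
        (≤-numerator C)))
      where
      instance _ = 2^n≢0 n
      xs = filterᵇ slow (strings n)
      r : Str → ℚ
      r x = + rate x / 1
      slow-rate : ∀ x → length x ≡ n → T (slow x) → r x ≡ + slowRate n / 1
      slow-rate x refl s with slow x
      ... | true = refl
      constant : All (λ x → term weight r x ≡ + suc n / 2 ^ n) xs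
      constant = All.zipWith (λ (l , s) → slow-term r _ l (slow-rate _ l s))
        (All.filter⁺ (T? ∘ slow) (strings-length n) , All.all-filter (T? ∘ slow) (strings n))

-- The limit of the fraction of uncertain answers.

-- If S ≤ LD, then L(1+n) ≤ cS ≤ L(cD) with L nonzero; cancelling L gives 1+n ≤ cD, against cD ≤ n.
count-bound : ∀ L S n c D .{{_ : NonZero S}} → L * suc n ℕ.≤ c * S → c * D ℕ.≤ n → L * D ℕ.< S
count-bound L S n c D LN≤cS cD≤n = ℕ.≰⇒> λ S≤LD → ℕ.<⇒≱ (s≤s cD≤n)
  (ℕ.*-cancelˡ-≤ L {{L≢0 S≤LD}} (begin
    L * suc n   ≤⟨ LN≤cS ⟩
    c * S       ≤⟨ ℕ.*-monoʳ-≤ c S≤LD ⟩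
    c * (L * D) ≡⟨ solve 3 (λ X Y Z → X :* (Y :* Z) := Y :* (X :* Z)) refl c L D ⟩
    L * (c * D) ∎))
  where
  open ℕ.≤-Reasoning
  L≢0 : S ℕ.≤ L * D → NonZero L
  L≢0 h = ℕ.m*n≢0⇒m≢0 L {{ℕ.>-nonZero (ℕ.<-≤-trans (ℕ.>-nonZero⁻¹ S) h)}}

-- The hypothesis says L/S < 1/D for the denominator D of `δ`, and 1/D ≤ δ because the numerator is
-- at least 1.
/-<-positive : ∀ L S δ .{{_ : NonZero S}} → 0ℚ ℚ.< δ → L * ↧ₙ δ ℕ.< S → + L / S ℚ.< δ
/-<-positive L S δ 0<δ h = subst (+ L / S ℚ.<_) (numerator/denominator δ)
  (/-mono-< {L} {S} {ℤ.∣ ↥ δ ∣} {↧ₙ δ} (ℕ.<-≤-trans h (ℕ.m≤n*m S ℤ.∣ ↥ δ ∣ {{numerator≢0 δ}})))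
  where instance _ = ℚ.positive 0<δ

maybe-vanishes : ∀ {T : Set} (B : Str → T × Confidence) c →
  (∀ n .{{_ : NonZero n}} → length (maybeInputs B n) * suc n ℕ.≤ c * 2 ^ n) →
  ∀ δ → 0ℚ ℚ.< δ → ∃[ N ] ∀ n → N ℕ.≤ n → ℚ.∣ maybeFraction B n ℚ.- 0ℚ ∣ ℚ.< δ
-- For the denominator D of `δ`, any n ≥ cD makes the fraction smaller than 1/D; the successor also
-- ensures n ≥ 1, as `h` demands.
maybe-vanishes B c h δ 0<δ = suc (c * ↧ₙ δ) , bound
  where
  bound : ∀ n → suc (c * ↧ₙ δ) ℕ.≤ n → ℚ.∣ maybeFraction B n ℚ.- 0ℚ ∣ ℚ.< δ
  bound n cD<n = subst (ℚ._< δ)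
    (sym (trans (cong ℚ.∣_∣ (ℚ.+-identityʳ (maybeFraction B n)))
      (ℚ.0≤p⇒∣p∣≡p (/-mono-≤ {0} {1} {L} {S} z≤n))))
    (/-<-positive L S δ 0<δ (count-bound L S n c (↧ₙ δ)
      (subst (λ m → L * suc n ℕ.≤ c * m) (sym (length-strings n))
        (h n {{ℕ.>-nonZero (ℕ.≤-trans (s≤s z≤n) cD<n)}}))
      (ℕ.<⇒≤ cD<n)))
    where
    instance _ = strings-nonempty n
    L = length (maybeInputs B n)
    S = length (strings n)

corollary2p2 : (f : Str → Str) → AvgP (f , standardUniform) →
    HasFrequentlySelfKnowinglyCorrectPolynomialTimeAlgorithm f
corollary2p2 f (M , t , computes , ε , 0<ε , C , bounded) =
  B , (answer-correct f t computes , maybe-vanishes B ℤ.∣ ↥ C ∣ (slow-count C bounded)) ,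
  clocked , time f t computes , clocked-computes f t computes ,
  timePoly (4 * b) , λ x → time-bound (4 * b) (length x) _ (ℕ.m⊓n≤n (t x) _)
  where
  -- Openness of the lower cut of `ε` at 0 yields a rational a/b with 0 < a/b < ε; its denominator b
  -- fixes the number of clock digits.
  δ = proj₁ (ℝ.lower-open ε 0<ε)
  0<δ = proj₁ (proj₂ (ℝ.lower-open ε 0<ε))
  δ<ε = proj₂ (proj₂ (ℝ.lower-open ε 0<ε))
  b = ↧ₙ δ
  open Clocked M (2 + 4 * b)
  B = answer f t computes
  slow : ∀ x → T (isMaybe (proj₂ (B x))) → suc (length x) ^ (4 * b) ℕ.≤ t x
  slow x h = begin
    suc n ^ (4 * b)           ≤⟨ ℕ.^-monoʳ-≤ (suc n) (ℕ.m≤n+m (4 * b) 2) ⟩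
    suc n ^ (2 + 4 * b)       ≡⟨ suc-ticks (2 + 4 * b) n ⟨
    -- A timeout means strictly more steps than ticks, which supplies the 1 missing from the full
    -- power of 1+n.
    suc (ticks (2 + 4 * b) n) ≤⟨ maybe⇒slow f t computes x h ⟩
    t x                       ∎
    where
    open ℕ.≤-Reasoning
    n = length x
  open Average t ε δ 0<δ δ<ε (isMaybe ∘ proj₂ ∘ B) slow
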